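{- Fix rationals $1<\alpha<\beta<2$, and for each $n\in\mathbb N$ let $Z_n=\{2^n(2t+1):t\in\mathbb N\}$. Then the sets $Z_n$ are pairwise disjoint, infinite, and uniformly computable. Define, for each $n,k\in\mathbb N$, $u_n(k)=\beta$ if $k\in Z_n$ and $u_n(k)=\alpha$ if $k\notin Z_n$, and let $D=\{(n,m)\in\mathbb N^2:n\ne m\}$. Then there exist a set $A\subseteq\mathbb N$ with $A\le_T\emptyset'$ and a uniformly computable family of total surjective functions $h_n:\mathbb N\to\mathbb N$ ($n\in\mathbb N$) forming a profile coding for $(\{u_n\}_{n\in\mathbb N},D)$, such that, with $W_n=C_n$ where $C_n(x)=A(h_n(x))$, one has $$W_n\equiv_{\rm bfo}A\quad\text{for every }n\in\mathbb N,$$ and $$W_n\not\le_1 W_m\quad\text{whenever }n\ne m.$$ Hence $\{\deg_1(W_n)\}_{n\in\mathbb N}$ is an infinite antichain of $1$-degrees inside a single bounded finite-one degree.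
   Context: Sets $A\subseteq\mathbb N=\{0,1,\dots\}$ are identified with their characteristic functions: $A(x)=1$ if $x\in A$, $A(x)=0$ otherwise. $\emptyset'$ is the Turing jump of the empty set. A family of functions $h_i$ is uniformly computable if $(i,x)\mapsto h_i(x)$ is computable; a family of sets is uniformly computable if its characteristic functions are. For $A,B\subseteq\mathbb N$: $A\le_1 B$ means there is a total computable injective $f:\mathbb N\to\mathbb N$ with $x\in A\iff f(x)\in B$ for all $x$. $A\le_{\rm bfo}B$ means there are a total computable $f:\mathbb N\to\mathbb N$ and a constant $c\ge1$ with $x\in A\iff f(x)\in B$ for all $x$ and $|f^{ -1}(y)|\le c$ for all $y$. For $r\in\{1,{\rm bfo}\}$, $A\equiv_r B$ means $A\le_r B$ and $B\le_r A$. The equivalence classes of $\equiv_1$ are the $1$-degrees ($\deg_1(X)$ is that of $X$), those of $\equiv_{\rm bfo}$ the bounded finite-one degrees. Since $\le_1$ implies $\le_{\rm bfo}$, each bounded finite-one degree is a union of $1$-degrees; these are partially ordered by $\deg_1(X)\le\deg_1(Y)\iff X\le_1 Y$. Block-density profiles are functions $u:\mathbb N\to\mathbb Q\cap(1,2)$. Given a family of profiles $\{u_i\}_{i\in\mathbb N}$ and $D\subseteq\mathbb N^2$, say that $A$ and $(h_i)_{i\in\mathbb N}$ form a profile coding for $(\{u_i\},D)$ if, with $a_0=0$, $a_{k+1}=a_k+k!$, $I_k=[a_k,a_{k+1})$ and $C_i(x)=A(h_i(x))$: (a) $A$ is constant on each $I_k$; (b) $|h_i^{ -1}(y)|\le2$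 for all $i,y$; (c) $C_i\equiv_{\rm bfo}A$ for all $i$; (d) if $u_i(k)\le u_j(k)$ for all $k$, then $C_i\le_1 C_j$; (e) if $(i,j)\in D$, then $C_i\not\le_1 C_j$. -}

module Defs where

open import Level using (0ℓ)
open import Data.Bool.Base using (if_then_else_)
open import Data.Integer.Base using (+_)
open import Data.List.Base using (List; length)
open import Data.List.Relation.Unary.All using (All)
open import Data.List.Relation.Unary.Unique.Propositional using (Unique)
open import Data.Nat.Base
  using (ℕ; zero; suc; _+_; _*_; _^_; _!; _≤_; _<_; _⊔_; s≤s)
open import Data.Nat.Properties
  using (_≟_; anyUpTo?; +-comm; +-suc; +-identityʳ; m≤m+n; m≤n*m; m^n≢0; ≤-trans;
         m⊔n≤o⇒m≤o; m⊔n≤o⇒n≤o; m≤m⊔n; m≤n⊔m)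
open import Data.Product.Base using (Σ-syntax; ∃-syntax; _×_; _,_; proj₁; proj₂)
open import Data.Rational.Base as ℚ using (ℚ; 1ℚ)
import Data.Rational.Properties as ℚ
open import Function.Base using (_∘_; id)
open import Function.Bundles using (_⇔_; mk⇔)
open import Function.Construct.Composition using (_⇔-∘_)
open import Function.Definitions using (Injective)
open import Relation.Binary.Bundles using (Poset)
open import Relation.Binary.Construct.Interior.Symmetric using (SymInterior; poset)
open import Relation.Binary.Core using (Rel)
open import Relation.Binary.Definitions using (Reflexive; Transitive)
open import Relation.Binary.PropositionalEquality
  using (_≡_; refl; sym; trans; cong; cong₂; subst)
open import Relation.Nullary.Decidable using (Dec; does; map′)
open import Relation.Nullary.Negation using (¬_)
open import Relation.Unary using (Pred; _∈_; _∉_; _⊢_; ⋃; ∅)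

-- Sets of natural numbers are predicates: the sets of interest are not
-- computable, so they have no closed representation as functions ℕ → Bool.
-- χ A x v says that the characteristic function of A has value v at x.

Subset : Set₁
Subset = Pred ℕ 0ℓ

data χ (A : Subset) (x : ℕ) : ℕ → Set where
  inside  : x ∈ A → χ A x 1
  outside : x ∉ A → χ A x 0

------------------------------------------------------------------------
-- Cantor pairing

triangle : ℕ → ℕ
triangle zero    = 0
triangle (suc n) = suc n + triangle n

⟨_,_⟩ : ℕ → ℕ → ℕ
⟨ x , y ⟩ = triangle (x + y) + y

-- The enumeration (0,0), (1,0), (0,1), (2,0), (1,1), (0,2), …

next : ℕ × ℕ → ℕ × ℕ
next (zero  , y) = suc y , 0
next (suc x , y) = x , suc y

unpair : ℕ → ℕ × ℕ
unpair zero    = 0 , 0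
unpair (suc n) = next (unpair n)

π₁ π₂ : ℕ → ℕ
π₁ n = proj₁ (unpair n)
π₂ n = proj₂ (unpair n)

private
  triangle-step : ∀ y → ⟨ suc y , 0 ⟩ ≡ suc ⟨ 0 , y ⟩
  triangle-step y rewrite +-identityʳ y | +-identityʳ (y + triangle y)
                        = cong suc (+-comm y (triangle y))

  diagonal-step : ∀ x y → ⟨ x , suc y ⟩ ≡ suc ⟨ suc x , y ⟩
  diagonal-step x y rewrite +-suc x y = cong suc (+-suc (x + y + triangle (x + y)) y)

  pair-next : ∀ p → ⟨ proj₁ (next p) , proj₂ (next p) ⟩ ≡ suc ⟨ proj₁ p , proj₂ p ⟩
  pair-next (zero  , y) = triangle-step y
  pair-next (suc x , y) = diagonal-step x y

  suc-injective : ∀ {m n} → suc m ≡ suc n → m ≡ n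
  suc-injective refl = refl

  unpair-pair′ : ∀ n x y → ⟨ x , y ⟩ ≡ n → unpair n ≡ (x , y)
  unpair-pair′ zero    zero    zero    _  = refl
  unpair-pair′ (suc n) (suc x) zero    eq =
    cong next (unpair-pair′ n zero x (suc-injective (trans (sym (triangle-step x)) eq)))
  unpair-pair′ (suc n) x       (suc y) eq =
    cong next (unpair-pair′ n (suc x) y (suc-injective (trans (sym (diagonal-step x y)) eq)))
  unpair-pair′ zero    zero    (suc y) ()
  unpair-pair′ zero    (suc x) _       ()
  unpair-pair′ (suc n) zero    zero    ()

unpair-pair : ∀ x y → unpair ⟨ x , y ⟩ ≡ (x , y)
unpair-pair x y = unpair-pair′ _ x y refl

pair-unpair : ∀ n → ⟨ π₁ n , π₂ n ⟩ ≡ n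
pair-unpair zero    = refl
pair-unpair (suc n) = trans (pair-next (unpair n)) (cong suc (pair-unpair n))

------------------------------------------------------------------------
-- Oracle computability: unary partial recursive functions over a pairing,
-- with one additional initial function, the characteristic function of the
-- oracle.

data Code : Set where
  zero succ left right oracle : Code
  pair comp prec              : Code → Code → Code
  rfind                       : Code → Code

infix 4 _⊩_[_]⇓_

-- B ⊩ c [ x ]⇓ y : with oracle B, program c halts on input x with output y.
-- Primitive recursion takes ⟨ a , n ⟩ and recurses on n; rfind c on x is the
-- least m with c ⟨ x , m ⟩ = 0, all earlier values being defined and nonzero.

data _⊩_[_]⇓_ (B : Subset) : Code → ℕ → ℕ → Set where
  zero⇓   : ∀ {x} → B ⊩ zero [ x ]⇓ 0
  succ⇓   : ∀ {x} → B ⊩ succ [ x ]⇓ suc x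
  left⇓   : ∀ {x} → B ⊩ left [ x ]⇓ π₁ x
  right⇓  : ∀ {x} → B ⊩ right [ x ]⇓ π₂ x
  oracle⇓ : ∀ {x v} → χ B x v → B ⊩ oracle [ x ]⇓ v
  pair⇓   : ∀ {c d x y z} → B ⊩ c [ x ]⇓ y → B ⊩ d [ x ]⇓ z →
            B ⊩ pair c d [ x ]⇓ ⟨ y , z ⟩
  comp⇓   : ∀ {c d x y z} → B ⊩ d [ x ]⇓ y → B ⊩ c [ y ]⇓ z →
            B ⊩ comp c d [ x ]⇓ z
  prec-0⇓ : ∀ {c d x y} → π₂ x ≡ 0 → B ⊩ c [ π₁ x ]⇓ y →
            B ⊩ prec c d [ x ]⇓ y
  prec-s⇓ : ∀ {c d x n v y} → π₂ x ≡ suc n →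
            B ⊩ prec c d [ ⟨ π₁ x , n ⟩ ]⇓ v →
            B ⊩ d [ ⟨ π₁ x , ⟨ n , v ⟩ ⟩ ]⇓ y →
            B ⊩ prec c d [ x ]⇓ y
  rfind⇓  : ∀ {c x m} → B ⊩ c [ ⟨ x , m ⟩ ]⇓ 0 →
            (∀ j → j < m → ∃[ v ] B ⊩ c [ ⟨ x , j ⟩ ]⇓ suc v) →
            B ⊩ rfind c [ x ]⇓ m

-- Gödel numbering; ⌜⌝-injective below shows that it is unambiguous.

⌜_⌝ : Code → ℕ
⌜ zero     ⌝ = ⟨ 0 , 0 ⟩
⌜ succ     ⌝ = ⟨ 1 , 0 ⟩
⌜ left     ⌝ = ⟨ 2 , 0 ⟩
⌜ right    ⌝ = ⟨ 3 , 0 ⟩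
⌜ oracle   ⌝ = ⟨ 4 , 0 ⟩
⌜ pair c d ⌝ = ⟨ 5 , ⟨ ⌜ c ⌝ , ⌜ d ⌝ ⟩ ⟩
⌜ comp c d ⌝ = ⟨ 6 , ⟨ ⌜ c ⌝ , ⌜ d ⌝ ⟩ ⟩
⌜ prec c d ⌝ = ⟨ 7 , ⟨ ⌜ c ⌝ , ⌜ d ⌝ ⟩ ⟩
⌜ rfind c  ⌝ = ⟨ 8 , ⌜ c ⌝ ⟩

private
  mutual
    decode : ℕ → ℕ → Code
    decode zero       _ = zero
    decode (suc fuel) n = decodeTag fuel (unpair n)

    decodeTag : ℕ → ℕ × ℕ → Code
    decodeTag fuel (1 , _) = succ
    decodeTag fuel (2 , _) = left
    decodeTag fuel (3 , _) = right
    decodeTag fuel (4 , _) = oracle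
    decodeTag fuel (5 , n) = decode₂ fuel pair (unpair n)
    decodeTag fuel (6 , n) = decode₂ fuel comp (unpair n)
    decodeTag fuel (7 , n) = decode₂ fuel prec (unpair n)
    decodeTag fuel (8 , n) = rfind (decode fuel n)
    decodeTag fuel _       = zero

    decode₂ : ℕ → (Code → Code → Code) → ℕ × ℕ → Code
    decode₂ fuel K (m , n) = K (decode fuel m) (decode fuel n)

  depth : Code → ℕ
  depth (pair c d) = suc (depth c ⊔ depth d)
  depth (comp c d) = suc (depth c ⊔ depth d)
  depth (prec c d) = suc (depth c ⊔ depth d)
  depth (rfind c)  = suc (depth c)
  depth _          = 1

  mutual
    decode-⌜⌝ : ∀ c fuel → depth c ≤ fuel → decode fuel ⌜ c ⌝ ≡ c
    decode-⌜⌝ zero       (suc _) _ = refl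
    decode-⌜⌝ succ       (suc _) _ = refl
    decode-⌜⌝ left       (suc _) _ = refl
    decode-⌜⌝ right      (suc _) _ = refl
    decode-⌜⌝ oracle     (suc _) _ = refl
    decode-⌜⌝ (pair c d) (suc fuel) (s≤s p)
      rewrite unpair-pair 5 ⟨ ⌜ c ⌝ , ⌜ d ⌝ ⟩ = decode₂-⌜⌝ pair c d fuel p
    decode-⌜⌝ (comp c d) (suc fuel) (s≤s p)
      rewrite unpair-pair 6 ⟨ ⌜ c ⌝ , ⌜ d ⌝ ⟩ = decode₂-⌜⌝ comp c d fuel p
    decode-⌜⌝ (prec c d) (suc fuel) (s≤s p)
      rewrite unpair-pair 7 ⟨ ⌜ c ⌝ , ⌜ d ⌝ ⟩ = decode₂-⌜⌝ prec c d fuel p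
    decode-⌜⌝ (rfind c)  (suc fuel) (s≤s p)
      rewrite unpair-pair 8 ⌜ c ⌝ = cong rfind (decode-⌜⌝ c fuel p)

    decode₂-⌜⌝ : ∀ K c d fuel → depth c ⊔ depth d ≤ fuel →
                 decode₂ fuel K (unpair ⟨ ⌜ c ⌝ , ⌜ d ⌝ ⟩) ≡ K c d
    decode₂-⌜⌝ K c d fuel p rewrite unpair-pair ⌜ c ⌝ ⌜ d ⌝ =
      cong₂ K (decode-⌜⌝ c fuel (m⊔n≤o⇒m≤o (depth c) (depth d) p))
              (decode-⌜⌝ d fuel (m⊔n≤o⇒n≤o (depth c) (depth d) p))

⌜⌝-injective : Injective _≡_ _≡_ ⌜_⌝
⌜⌝-injective {c} {d} eq =
  trans (sym (decode-⌜⌝ c fuel (m≤m⊔n (depth c) (depth d))))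
        (trans (cong (decode fuel) eq) (decode-⌜⌝ d fuel (m≤n⊔m (depth c) (depth d))))
  where fuel = depth c ⊔ depth d

infix 4 _≤T_

_≤T_ : Subset → Subset → Set
A ≤T B = ∃[ c ] ∀ x v → χ A x v → B ⊩ c [ x ]⇓ v

jump : Subset → Subset
jump B e = ∃[ c ] (⌜ c ⌝ ≡ e × ∃[ y ] B ⊩ c [ e ]⇓ y)

∅′ : Subset
∅′ = jump ∅

-- Plain computability is computability with the empty oracle, whose
-- characteristic function is the constant 0.

Computable : (ℕ → ℕ) → Set
Computable f = ∃[ c ] ∀ x → ∅ ⊩ c [ x ]⇓ f x

UniformlyComputable : (ℕ → ℕ → ℕ) → Set
UniformlyComputable h = ∃[ c ] ∀ i x → ∅ ⊩ c [ ⟨ i , x ⟩ ]⇓ h i x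

UniformlyComputableSets : (ℕ → Subset) → Set
UniformlyComputableSets S = ∃[ c ] ∀ i x v → χ (S i) x v → ∅ ⊩ c [ ⟨ i , x ⟩ ]⇓ v

------------------------------------------------------------------------
-- Reducibilities and degrees

infix 4 _≤₁_ _≡₁_ _≤bfo_ _≡bfo_

CardAtMost : ℕ → Subset → Set
CardAtMost c S = ∀ (xs : List ℕ) → Unique xs → All (_∈ S) xs → length xs ≤ c

fibre : (ℕ → ℕ) → ℕ → Subset
fibre f y x = f x ≡ y

_≤₁_ : Rel Subset 0ℓ
A ≤₁ B = ∃[ f ] (Computable f × Injective _≡_ _≡_ f × (∀ x → x ∈ A ⇔ f x ∈ B))

_≤bfo_ : Rel Subset 0ℓ
A ≤bfo B = ∃[ f ] (Computable f
  × ∃[ c ] (1 ≤ c × (∀ x → x ∈ A ⇔ f x ∈ B) × (∀ y → CardAtMost c (fibre f y))))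

_≡₁_ : Rel Subset 0ℓ
_≡₁_ = SymInterior _≤₁_

_≡bfo_ : Rel Subset 0ℓ
_≡bfo_ = SymInterior _≤bfo_

deg₁ : Subset → Pred Subset 0ℓ
deg₁ X Y = Y ≡₁ X

degbfo : Subset → Pred Subset 0ℓ
degbfo X Y = Y ≡bfo X

≤₁-refl : Reflexive _≤₁_
≤₁-refl = id , (pair left right , λ x →
  subst (∅ ⊩ pair left right [ x ]⇓_) (pair-unpair x) (pair⇓ left⇓ right⇓)) ,
  id , λ x → mk⇔ id id

≤₁-trans : Transitive _≤₁_
≤₁-trans (f , (c , cf) , f-inj , f-red) (g , (d , dg) , g-inj , g-red) =
  g ∘ f , (comp d c , λ x → comp⇓ (cf x) (dg (f x))) ,
  f-inj ∘ g-inj , λ x → g-red (f x) ⇔-∘ f-red x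

-- The poset of 1-degrees.  A degree is given by a representative, and two
-- representatives are equal when they are ≡₁.

OneDegrees : Poset _ 0ℓ 0ℓ
OneDegrees = poset {R = _≤₁_} ≤₁-refl
  (λ {X} {Y} {Z} → ≤₁-trans {X} {Y} {Z})

Infinite : ∀ {a ℓ s} {A : Set a} → Rel A ℓ → Pred A s → Set _
Infinite {A = A} _≈_ S =
  Σ[ f ∈ (ℕ → A) ] ((∀ n → f n ∈ S) × Injective _≡_ _≈_ f)

Antichain : ∀ {a ℓ₁ ℓ₂ s} (P : Poset a ℓ₁ ℓ₂) → Pred (Poset.Carrier P) s → Set _
Antichain P S = ∀ {x y} → x ∈ S → y ∈ S → ¬ (x ≈ y) → ¬ (x ⊑ y)
  where open Poset P renaming (_≤_ to _⊑_)

InfiniteAntichain : ∀ {a ℓ₁ ℓ₂ s} (P : Poset a ℓ₁ ℓ₂) → Pred (Poset.Carrier P) s → Set _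
InfiniteAntichain P S = Infinite (Poset._≈_ P) S × Antichain P S

-- {deg₁ (W n) : n ∈ ℕ}, as the collection of all representatives of its
-- members; equivalently, the union of these 1-degrees.

OneDegreesOf : (ℕ → Subset) → Pred Subset 0ℓ
OneDegreesOf W = ⋃ ℕ (λ n → deg₁ (W n))

------------------------------------------------------------------------
-- Profile codings

2ℚ : ℚ
2ℚ = + 2 ℚ./ 1

Profile : Set
Profile = ℕ → Σ[ q ∈ ℚ ] (1ℚ ℚ.< q × q ℚ.< 2ℚ)

infix 4 _≼_

_≼_ : Rel Profile 0ℓ
u ≼ w = ∀ k → proj₁ (u k) ℚ.≤ proj₁ (w k)

blockStart : ℕ → ℕ
blockStart zero    = 0
blockStart (suc k) = blockStart k + k !

Block : ℕ → Subset
Block k x = blockStart k ≤ x × x < blockStart (suc k)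

coded : Subset → (ℕ → ℕ → ℕ) → ℕ → Subset
coded A h i = h i ⊢ A

record IsProfileCoding (u : ℕ → Profile) (D : Rel ℕ 0ℓ)
                       (A : Subset) (h : ℕ → ℕ → ℕ) : Set where
  field
    constant-on-blocks : ∀ k {x y} → x ∈ Block k → y ∈ Block k → x ∈ A → y ∈ A
    two-bounded        : ∀ i y → CardAtMost 2 (fibre (h i) y)
    coded-≡bfo         : ∀ i → coded A h i ≡bfo A
    monotone           : ∀ {i j} → u i ≼ u j → coded A h i ≤₁ coded A h j
    separated          : ∀ {i j} → D i j → ¬ (coded A h i ≤₁ coded A h j)

------------------------------------------------------------------------
-- The two-valued profiles

Z : ℕ → Subset
Z n k = ∃[ t ] k ≡ 2 ^ n * (2 * t + 1)

Z? : ∀ n k → Dec (k ∈ Z n)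
Z? n k = map′ (λ (t , _ , eq) → t , eq)
              (λ (t , eq) → t , s≤s (subst (t ≤_) (sym eq) (bound t)) , eq)
              (anyUpTo? (λ t → k ≟ 2 ^ n * (2 * t + 1)) (suc k))
  where
  bound : ∀ t → t ≤ 2 ^ n * (2 * t + 1)
  bound t = ≤-trans (≤-trans (m≤m+n t (t + 0)) (m≤m+n (2 * t) 1))
                    (m≤n*m (2 * t + 1) (2 ^ n) {{m^n≢0 2 n}})

twoValued : ∀ {α β} → 1ℚ ℚ.< α → α ℚ.< β → β ℚ.< 2ℚ → ℕ → Profile
twoValued {α} {β} 1<α α<β β<2 n k =
  if does (Z? n k)
  then (β , ℚ.<-trans 1<α α<β , β<2)
  else (α , 1<α , ℚ.<-trans α<β β<2)

{-# OPTIONS --safe #-}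
module Submission where

-- Each h n sends 2x to x, while on the odd numbers it enumerates the blocks I_k with k ∈ Z n; so it
-- takes the values in these blocks twice and all others once.
-- A is a union of blocks I_{k₀}, I_{k₁}, …, where k_s ∈ Z n and k_{s+1} exceeds φ_e(k_s), if
-- defined, for s = ⟨ e , n ⟩; with the oracle ∅′ such a bound can be computed.
-- If an injective computable f reduced C_n to C_m with n ≠ m, choose s such that k = k_s ∈ Z n
-- and k_{s+1} exceeds h m (f x) for all x in h n ⁻¹(I_k).  These 2 · k! numbers x lie in C_n,
-- so h m (f x) lies in A below k_{s+1}, hence below a_{k+1}.  But as k ∉ Z m, at most
-- a_{k+1} + a_k = k! + 2 a_k numbers y have h m y < a_{k+1}, and 2 a_k < k!.
-- Monotonicity is trivial, since the profiles u_n are pairwise incomparable.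

open import Defs
open import Level using (0ℓ)
open import Axiom.ExcludedMiddle using (ExcludedMiddle)
open import Data.Bool.Base using (Bool; if_then_else_)
open import Data.Fin.Base using (fromℕ<; toℕ)
open import Data.Fin.Properties using (injective⇒≤; fromℕ<-injective; toℕ-injective; toℕ<n)
open import Data.List.Base using ([]; _∷_; map)
open import Data.List.Properties using (length-map)
open import Data.List.Relation.Unary.All using ([]; _∷_)
import Data.List.Relation.Unary.All.Properties as All
open import Data.List.Relation.Unary.AllPairs using ([]; _∷_)
import Data.List.Relation.Unary.Unique.Propositional.Properties as Unique
open import Data.Nat.Base
  using (ℕ; zero; suc; pred; _+_; _*_; _∸_; _^_; _!; _≤_; z≤n; s≤s; >-nonZero⁻¹)
import Data.Nat.Base as ℕ
open import Data.Nat.Properties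
open import Data.Nat.Solver using (module +-*-Solver)
open import Data.Product.Base using (Σ-syntax; ∃-syntax; _×_; _,_; proj₁; proj₂)
open import Data.Rational.Base using (ℚ; 1ℚ; _<_)
import Data.Rational.Base as ℚ
import Data.Rational.Properties as ℚ
open import Data.Sum.Base using (_⊎_; inj₁; inj₂)
open import Function.Base using (_∘_; id)
open import Function.Bundles using (mk⇔; Equivalence)
open import Function.Construct.Composition using (_⇔-∘_)
open import Function.Definitions using (Injective; Surjective)
open import Relation.Binary.Construct.Interior.Symmetric using (lhs≤rhs; rhs≤lhs)
open import Relation.Binary.Definitions using (tri<; tri≈; tri>)
open import Relation.Binary.PropositionalEquality
  using (_≡_; _≢_; refl; sym; trans; cong; cong₂; subst; subst₂; module ≡-Reasoning)
open import Relation.Nullary.Decidable using (yes; no; dec-true; dec-false)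
open import Relation.Nullary.Negation using (¬_; contradiction)
open import Relation.Unary using (_∈_; _∉_; _⊆_; _∩_; Empty; ∅)

-- Pairing, determinism of evaluation, numerals.

π₁-pair : ∀ x y → π₁ ⟨ x , y ⟩ ≡ x
π₁-pair x y = cong proj₁ (unpair-pair x y)

π₂-pair : ∀ x y → π₂ ⟨ x , y ⟩ ≡ y
π₂-pair x y = cong proj₂ (unpair-pair x y)

χ-deterministic : ∀ {B x v w} → χ B x v → χ B x w → v ≡ w
χ-deterministic (inside _)  (inside _)  = refl
χ-deterministic (inside p)  (outside q) = contradiction p q
χ-deterministic (outside q) (inside p)  = contradiction p q
χ-deterministic (outside _) (outside _) = refl

-- In the `rfind` case the smaller of two distinct results would be assigned both the value 0 and a
-- successor.
⇓-deterministic : ∀ {B c x y z} → B ⊩ c [ x ]⇓ y → B ⊩ c [ x ]⇓ z → y ≡ z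
⇓-deterministic zero⇓ zero⇓ = refl
⇓-deterministic succ⇓ succ⇓ = refl
⇓-deterministic left⇓ left⇓ = refl
⇓-deterministic right⇓ right⇓ = refl
⇓-deterministic (oracle⇓ p) (oracle⇓ q) = χ-deterministic p q
⇓-deterministic (pair⇓ p q) (pair⇓ p′ q′) =
  cong₂ ⟨_,_⟩ (⇓-deterministic p p′) (⇓-deterministic q q′)
⇓-deterministic (comp⇓ p q) (comp⇓ p′ q′) with refl ← ⇓-deterministic p p′ =
  ⇓-deterministic q q′
⇓-deterministic (prec-0⇓ _ p) (prec-0⇓ _ p′) = ⇓-deterministic p p′
⇓-deterministic (prec-0⇓ e _) (prec-s⇓ e′ _ _) with () ← trans (sym e) e′
⇓-deterministic (prec-s⇓ e _ _) (prec-0⇓ e′ _) with () ← trans (sym e) e′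
⇓-deterministic (prec-s⇓ e p q) (prec-s⇓ e′ p′ q′)
  with refl ← trans (sym e) e′ with refl ← ⇓-deterministic p p′ = ⇓-deterministic q q′
⇓-deterministic (rfind⇓ {m = m} p below) (rfind⇓ {m = m′} p′ below′) with <-cmp m m′
... | tri≈ _ m≡m′ _ = m≡m′
... | tri< m<m′ _ _ with () ← ⇓-deterministic p (proj₂ (below′ m m<m′))
... | tri> _ _ m′<m with () ← ⇓-deterministic (proj₂ (below m′ m′<m)) p′

numeral : ℕ → Code
numeral zero    = zero
numeral (suc n) = comp succ (numeral n)

numeral⇓ : ∀ {B x} n → B ⊩ numeral n [ x ]⇓ n
numeral⇓ zero    = zero⇓
numeral⇓ (suc n) = comp⇓ (numeral⇓ n) succ⇓

-- Computable functions

record ComputableIn (B : Subset) (f : ℕ → ℕ) : Set where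
  constructor computes
  field
    {code}  : Code
    correct : ∀ x → B ⊩ code [ x ]⇓ f x

open ComputableIn

-- A record rather than an abbreviation: unification cannot recover `f` from
-- `λ p → f (π₁ p) (π₂ p)`.
record Computable₂In (B : Subset) (f : ℕ → ℕ → ℕ) : Set where
  constructor uncurried
  field
    uncurry : ComputableIn B (λ p → f (π₁ p) (π₂ p))

open Computable₂In

module _ {B : Subset} where

  respects : ∀ {f g} → (∀ x → f x ≡ g x) → ComputableIn B f → ComputableIn B g
  respects f≗g (computes cf) = computes λ x → subst (B ⊩ _ [ x ]⇓_) (f≗g x) (cf x)

  constant : ∀ n → ComputableIn B (λ _ → n)
  constant n = computes λ _ → numeral⇓ n

  identity : ComputableIn B id
  identity = computes λ x → subst (B ⊩ pair left right [ x ]⇓_) (pair-unpair x) (pair⇓ left⇓ right⇓)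

  infixr 9 _∘ᶜ_

  _∘ᶜ_ : ∀ {f g} → ComputableIn B f → ComputableIn B g → ComputableIn B (f ∘ g)
  computes cf ∘ᶜ computes cg = computes λ x → comp⇓ (cg x) (cf _)

  π₁ᶜ : ComputableIn B π₁
  π₁ᶜ = computes λ _ → left⇓

  π₂ᶜ : ComputableIn B π₂
  π₂ᶜ = computes λ _ → right⇓

  sucᶜ : ComputableIn B suc
  sucᶜ = computes λ _ → succ⇓

  infix 4 ⟨_,_⟩ᶜ

  ⟨_,_⟩ᶜ : ∀ {f g} → ComputableIn B f → ComputableIn B g → ComputableIn B (λ x → ⟨ f x , g x ⟩)
  ⟨ computes cf , computes cg ⟩ᶜ = computes λ x → pair⇓ (cf x) (cg x)

  apply₂ : ∀ {f g h} → Computable₂In B f → ComputableIn B g → ComputableIn B h →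
           ComputableIn B (λ x → f (g x) (h x))
  apply₂ {f} {g} {h} (uncurried cf) cg ch =
    respects (λ x → cong₂ f (π₁-pair (g x) (h x)) (π₂-pair (g x) (h x))) (cf ∘ᶜ ⟨ cg , ch ⟩ᶜ)

  -- `r` is any function already at hand that satisfies the recursion equations propositionally; its
  -- program is assembled from those of `g` and `s`.
  primitive-recursion :
    ∀ {g : ℕ → ℕ} {s : ℕ → ℕ → ℕ → ℕ} {r : ℕ → ℕ → ℕ} →
    ComputableIn B g → ComputableIn B (λ p → s (π₁ p) (π₁ (π₂ p)) (π₂ (π₂ p))) →
    (∀ a → g a ≡ r a 0) → (∀ a n → s a n (r a n) ≡ r a (suc n)) →
    Computable₂In B r
  primitive-recursion {g} {s} {r} (computes {c} cg) (computes {d} cs) r-zero r-suc =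
    uncurried (computes λ p →
      subst (B ⊩ prec c d [_]⇓ r (π₁ p) (π₂ p)) (pair-unpair p) (loop (π₁ p) (π₂ p)))
    where
    loop : ∀ a n → B ⊩ prec c d [ ⟨ a , n ⟩ ]⇓ r a n
    loop a zero = prec-0⇓ (π₂-pair a 0)
      (subst₂ (B ⊩ c [_]⇓_) (sym (π₁-pair a 0)) (r-zero a) (cg a))
    loop a (suc n) = prec-s⇓ (π₂-pair a (suc n))
      (subst (λ b → B ⊩ prec c d [ ⟨ b , n ⟩ ]⇓ r a n) (sym (π₁-pair a (suc n))) (loop a n))
      (subst₂ (B ⊩ d [_]⇓_) (cong ⟨_, ⟨ n , r a n ⟩ ⟩ (sym (π₁-pair a (suc n)))) step
        (cs ⟨ a , ⟨ n , r a n ⟩ ⟩))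
      where
      step : s (π₁ ⟨ a , ⟨ n , r a n ⟩ ⟩) (π₁ (π₂ ⟨ a , ⟨ n , r a n ⟩ ⟩))
               (π₂ (π₂ ⟨ a , ⟨ n , r a n ⟩ ⟩)) ≡ r a (suc n)
      step rewrite unpair-pair a ⟨ n , r a n ⟩ | unpair-pair n (r a n) = r-suc a n

  primitive-recursion₁ :
    ∀ {s : ℕ → ℕ → ℕ} {r : ℕ → ℕ} →
    Computable₂In B s → (∀ n → s n (r n) ≡ r (suc n)) → ComputableIn B r
  primitive-recursion₁ {s} {r} cs r-suc =
    apply₂ (primitive-recursion {s = λ _ → s} (constant (r 0)) (uncurry cs ∘ᶜ π₂ᶜ)
              (λ _ → refl) (λ _ → r-suc))
      (constant 0) identity

  -- `g` may be defined by any means, classical case distinctions included, as long as it picks the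
  -- least zero; this is how `bound` becomes computable in `∅′`.
  minimisation : ∀ {f : ℕ → ℕ → ℕ} {g : ℕ → ℕ} → Computable₂In B f →
    (∀ x → f x (g x) ≡ 0) → (∀ x j → j ℕ.< g x → f x j ≢ 0) → ComputableIn B g
  minimisation {f} {g} (uncurried (computes {c} cf)) zero-at nonzero-below =
    computes λ x → rfind⇓ (subst (B ⊩ c [ _ ]⇓_) (zero-at x) (value x (g x))) (below x)
    where
    value : ∀ x j → B ⊩ c [ ⟨ x , j ⟩ ]⇓ f x j
    value x j = subst (B ⊩ c [ _ ]⇓_) (cong₂ f (π₁-pair x j) (π₂-pair x j)) (cf ⟨ x , j ⟩)

    below : ∀ x j → j ℕ.< g x → ∃[ v ] B ⊩ c [ ⟨ x , j ⟩ ]⇓ suc v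
    below x j j<g with f x j | value x j | nonzero-below x j j<g
    ... | zero  | _ | ≢0 = contradiction refl ≢0
    ... | suc v | d | _  = v , d

  +ᶜ : Computable₂In B _+_
  +ᶜ = primitive-recursion {s = λ _ _ v → suc v} identity (sucᶜ ∘ᶜ π₂ᶜ ∘ᶜ π₂ᶜ)
    (λ a → sym (+-identityʳ a)) (λ a n → sym (+-suc a n))

  *ᶜ : Computable₂In B _*_
  *ᶜ = primitive-recursion {s = λ a _ v → a + v} (constant 0) (apply₂ +ᶜ π₁ᶜ (π₂ᶜ ∘ᶜ π₂ᶜ))
    (λ a → sym (*-zeroʳ a)) (λ a n → sym (*-suc a n))

  predᶜ : ComputableIn B pred
  predᶜ = primitive-recursion₁ {s = λ n _ → n} (uncurried π₁ᶜ) (λ _ → refl)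

  ∸ᶜ : Computable₂In B _∸_
  ∸ᶜ = primitive-recursion {s = λ _ _ v → pred v} identity (predᶜ ∘ᶜ π₂ᶜ ∘ᶜ π₂ᶜ)
    (λ _ → refl) (λ a n → pred[m∸n]≡m∸[1+n] a n)

  2^ᶜ : ComputableIn B (2 ^_)
  2^ᶜ = primitive-recursion₁ {s = λ _ v → 2 * v} (uncurried (apply₂ *ᶜ (constant 2) π₂ᶜ)) (λ _ → refl)

  !ᶜ : ComputableIn B _!
  !ᶜ = primitive-recursion₁ {s = λ n v → suc n * v}
    (uncurried (apply₂ *ᶜ (sucᶜ ∘ᶜ π₁ᶜ) π₂ᶜ)) (λ _ → refl)

  blockStartᶜ : ComputableIn B blockStart
  blockStartᶜ = primitive-recursion₁ {s = λ n v → v + n !}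
    (uncurried (apply₂ +ᶜ π₂ᶜ (!ᶜ ∘ᶜ π₁ᶜ))) (λ _ → refl)

-- Numerical functions

infix 5 if0_then_else_

if0_then_else_ : ℕ → ℕ → ℕ → ℕ
if0 zero  then a else b = a
if0 suc _ then a else b = b

if0ᶜ : ∀ {B f g h} → ComputableIn B f → ComputableIn B g → ComputableIn B h →
       ComputableIn B (λ x → if0 f x then g x else h x)
if0ᶜ {f = f} {g} {h} cf cg ch =
  respects (λ x → cong₂ (if0 f x then_else_) (π₁-pair (g x) (h x)) (π₂-pair (g x) (h x)))
    (apply₂ branch ⟨ cg , ch ⟩ᶜ cf)
  where
  branch : ∀ {B} → Computable₂In B (λ p n → if0 n then π₁ p else π₂ p)
  -- The parameter is the pair of both alternatives; every recursion step discards the previous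
  -- value and returns the second one.
  branch = primitive-recursion {s = λ p _ _ → π₂ p} π₁ᶜ (π₂ᶜ ∘ᶜ π₁ᶜ) (λ _ → refl) (λ _ _ → refl)

parity : ℕ → ℕ
parity zero    = 0
parity (suc n) = 1 ∸ parity n

half : ℕ → ℕ
half zero    = 0
half (suc n) = half n + parity n

parityᶜ : ∀ {B} → ComputableIn B parity
parityᶜ = primitive-recursion₁ {s = λ _ v → 1 ∸ v} (uncurried (apply₂ ∸ᶜ (constant 1) π₂ᶜ)) (λ _ → refl)

halfᶜ : ∀ {B} → ComputableIn B half
halfᶜ = primitive-recursion₁ {s = λ n v → v + parity n}
  (uncurried (apply₂ +ᶜ π₂ᶜ (parityᶜ ∘ᶜ π₁ᶜ))) (λ _ → refl)

-- Serves as a computable upper bound for finitely many values, in place of their maximum.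
sumBelow : (ℕ → ℕ) → ℕ → ℕ
sumBelow f zero    = 0
sumBelow f (suc n) = sumBelow f n + f n

sumBelowᶜ : ∀ {B f} → ComputableIn B f → ComputableIn B (sumBelow f)
sumBelowᶜ {f = f} cf = primitive-recursion₁ {s = λ n v → v + f n}
  (uncurried (apply₂ +ᶜ π₂ᶜ (cf ∘ᶜ π₁ᶜ))) (λ _ → refl)

≤-sumBelow : ∀ f {x n} → x ℕ.< n → f x ≤ sumBelow f n
≤-sumBelow f {n = suc n} x<1+n with m≤n⇒m<n∨m≡n (≤-pred x<1+n)
... | inj₁ x<n  = ≤-trans (≤-sumBelow f x<n) (m≤m+n _ (f n))
... | inj₂ refl = m≤n+m (f n) _

-- Membership is read off the least s with x < hi i s: by monotonicity, lo i s ≤ x is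
-- then tested for this s only.

between-computable :
  ∀ {B} {lo hi : ℕ → ℕ → ℕ} →
  Computable₂In B lo → Computable₂In B hi →
  (∀ i {s t} → s ≤ t → lo i s ≤ lo i t) → (∀ i x → x ℕ.< hi i x) →
  ∃[ c ] ∀ i x v → χ (λ y → ∃[ s ] (lo i s ≤ y × y ℕ.< hi i s)) x v → B ⊩ c [ ⟨ i , x ⟩ ]⇓ v
between-computable {B} {lo} {hi} clo chi lo-mono x<hi = code test ,
  λ i x v χv → subst (B ⊩ code test [ ⟨ i , x ⟩ ]⇓_)
    (trans (cong₂ decide (π₁-pair i x) (π₂-pair i x)) (decide-correct χv))
    (correct test ⟨ i , x ⟩)
  where
  least-zero : ∀ (f : ℕ → ℕ) n → f n ≡ 0 → ∃[ m ] (f m ≡ 0 × ∀ j → j ℕ.< m → f j ≢ 0)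
  least-zero f n       eq with f 0 ≟ 0
  least-zero f n       eq | yes f0≡0 = 0 , f0≡0 , λ _ ()
  least-zero f zero    eq | no f0≢0 = contradiction eq f0≢0
  least-zero f (suc n) eq | no f0≢0 with m , fm , below ← least-zero (f ∘ suc) n eq =
    suc m , fm , λ { zero _ → f0≢0 ; (suc j) (s≤s j<m) → below j j<m }

  -- `suc x ∸ hi i s ≡ 0` expresses `x < hi i s`; by hypothesis `s = x` is a zero, so the search
  -- ends.
  search : ∀ i x → ∃[ s ] (suc x ∸ hi i s ≡ 0 × ∀ j → j ℕ.< s → suc x ∸ hi i j ≢ 0)
  search i x = least-zero (λ s → suc x ∸ hi i s) x (m≤n⇒m∸n≡0 (x<hi i x))

  first : ℕ → ℕ → ℕ
  first i x = proj₁ (search i x)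

  firstᶜ : ComputableIn B (λ p → first (π₁ p) (π₂ p))
  firstᶜ = minimisation {f = λ p s → suc (π₂ p) ∸ hi (π₁ p) s}
    (uncurried (apply₂ ∸ᶜ (sucᶜ ∘ᶜ π₂ᶜ ∘ᶜ π₁ᶜ) (apply₂ chi (π₁ᶜ ∘ᶜ π₁ᶜ) π₂ᶜ)))
    (λ p → proj₁ (proj₂ (search (π₁ p) (π₂ p))))
    (λ p → proj₂ (proj₂ (search (π₁ p) (π₂ p))))

  decide : ℕ → ℕ → ℕ
  decide i x = if0 lo i (first i x) ∸ x then 1 else 0

  test : ComputableIn B (λ p → decide (π₁ p) (π₂ p))
  test = if0ᶜ (apply₂ ∸ᶜ (apply₂ clo π₁ᶜ firstᶜ) π₂ᶜ) (constant 1) (constant 0)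

  first-minimal : ∀ i x s → x ℕ.< hi i s → first i x ≤ s
  first-minimal i x s x<hi = ≮⇒≥ λ s<first →
    proj₂ (proj₂ (search i x)) s s<first (m≤n⇒m∸n≡0 x<hi)

  decide-correct : ∀ {i x v} → χ (λ y → ∃[ s ] (lo i s ≤ y × y ℕ.< hi i s)) x v → decide i x ≡ v
  decide-correct {i} {x} (inside (s , lo≤x , x<hi′))
    rewrite m≤n⇒m∸n≡0 (≤-trans (lo-mono i (first-minimal i x s x<hi′)) lo≤x) = refl
  decide-correct {i} {x} (outside x∉) with lo i (first i x) ∸ x in eq
  ... | zero  = contradiction
    (first i x , m∸n≡0⇒m≤n eq , m∸n≡0⇒m≤n (proj₁ (proj₂ (search i x)))) x∉
  ... | suc _ = refl

-- Arithmetic of parity and halving.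

parity-binary : ∀ n → parity n ≡ 0 ⊎ parity n ≡ 1
parity-binary zero = inj₁ refl
parity-binary (suc n) with parity-binary n
... | inj₁ eq rewrite eq = inj₂ refl
... | inj₂ eq rewrite eq = inj₁ refl

parity-+2* : ∀ c n → parity (2 * c + n) ≡ parity n
parity-+2* zero    n = refl
parity-+2* (suc c) n rewrite +-suc c (c + 0) =
  trans (double (2 * c + n)) (parity-+2* c n)
  where
  double : ∀ n → 1 ∸ (1 ∸ parity n) ≡ parity n
  double n with parity-binary n
  ... | inj₁ eq rewrite eq = refl
  ... | inj₂ eq rewrite eq = refl

half-+2* : ∀ c n → half (2 * c + n) ≡ c + half n
half-+2* zero    n = refl
half-+2* (suc c) n rewrite +-suc c (c + 0) =
  trans (step (2 * c + n)) (cong suc (half-+2* c n))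
  where
  step : ∀ n → half n + parity n + (1 ∸ parity n) ≡ suc (half n)
  step n with parity-binary n
  ... | inj₁ eq rewrite eq | +-identityʳ (half n) = +-comm (half n) 1
  ... | inj₂ eq rewrite eq | +-identityʳ (half n + 1) = +-comm (half n) 1

parity-half : ∀ n → n ≡ 2 * half n + parity n
parity-half zero    = refl
parity-half (suc n) with parity-binary n | parity-half n
... | inj₁ eq | ih rewrite eq = trans (cong suc ih)
  (solve 1 (λ h → con 1 :+ (con 2 :* h :+ con 0) := con 2 :* (h :+ con 0) :+ con 1) refl (half n))
  where open +-*-Solver
... | inj₂ eq | ih rewrite eq = trans (cong suc ih)
  (solve 1 (λ h → con 1 :+ (con 2 :* h :+ con 1) := con 2 :* (h :+ con 1) :+ con 0) refl (half n))
  where open +-*-Solver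

parity-half-injective : ∀ {m n} → parity m ≡ parity n → half m ≡ half n → m ≡ n
parity-half-injective {m} {n} p h =
  trans (parity-half m) (trans (cong₂ (λ h p → 2 * h + p) h p) (sym (parity-half n)))

-- Block boundaries and increasing sequences.

1≤! : ∀ n → 1 ≤ n !
1≤! n = >-nonZero⁻¹ (n !) {{n !≢0}}

blockStart-mono : ∀ {k l} → k ≤ l → blockStart k ≤ blockStart l
blockStart-mono {l = zero}  z≤n = ≤-refl
blockStart-mono {l = suc l} k≤1+l with m≤n⇒m<n∨m≡n k≤1+l
... | inj₁ k<1+l = ≤-trans (blockStart-mono (≤-pred k<1+l)) (m≤m+n _ (l !))
... | inj₂ refl  = ≤-refl

≤-blockStart : ∀ k → k ≤ blockStart k
≤-blockStart zero    = z≤n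
≤-blockStart (suc k) = subst (_≤ blockStart k + k !) (+-comm k 1) (+-mono-≤ (≤-blockStart k) (1≤! k))

-- Applied in both directions with successors for `l`, this shows that blocks with a common element
-- have the same index.
blockStart-< : ∀ {k l x} → blockStart k ≤ x → x ℕ.< blockStart l → k ℕ.< l
blockStart-< k≤x x<l = ≰⇒> λ l≤k → <⇒≱ x<l (≤-trans (blockStart-mono l≤k) k≤x)

-- In the induction step, `2 * k !` is absorbed by `k * k !`. The inequality lets the doubling of a
-- single block outweigh everything before it.
blockStart-growth : ∀ {k} → 4 ≤ k → 2 * blockStart k ℕ.< k !
blockStart-growth {suc k} 4≤1+k with m≤n⇒m<n∨m≡n 4≤1+k
-- `blockStart 4` is 10, so the claim reads `20 < 24`; for 3 it would fail, as `blockStart 3` is 4.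
... | inj₂ refl      = m≤m+n 21 3
... | inj₁ (s≤s 4≤k) = begin-strict
  2 * (blockStart k + k !)     ≡⟨ *-distribˡ-+ 2 (blockStart k) (k !) ⟩
  2 * blockStart k + 2 * k !   <⟨ +-mono-<-≤ (blockStart-growth 4≤k)
                                    (*-monoˡ-≤ (k !) (≤-trans (m≤m+n 2 2) 4≤k)) ⟩
  k ! + k * k !                ∎
  where open ≤-Reasoning

module _ {f : ℕ → ℕ} (increasing : ∀ n → f n ℕ.< f (suc n)) where

  strictly-monotone : ∀ {m n} → m ℕ.< n → f m ℕ.< f n
  strictly-monotone {n = suc n} m<1+n with m≤n⇒m<n∨m≡n (≤-pred m<1+n)
  ... | inj₁ m<n  = <-trans (strictly-monotone m<n) (increasing n)
  ... | inj₂ refl = increasing n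

  monotone-≤ : ∀ {m n} → m ≤ n → f m ≤ f n
  monotone-≤ m≤n with m≤n⇒m<n∨m≡n m≤n
  ... | inj₁ m<n  = <⇒≤ (strictly-monotone m<n)
  ... | inj₂ refl = ≤-refl

  increasing-injective : ∀ {m n} → f m ≡ f n → m ≡ n
  increasing-injective {m} {n} eq with <-cmp m n
  ... | tri≈ _ m≡n _ = m≡n
  ... | tri< m<n _ _ = contradiction eq (<⇒≢ (strictly-monotone m<n))
  ... | tri> _ _ n<m = contradiction (sym eq) (<⇒≢ (strictly-monotone n<m))

  increasing-≥ : ∀ n → n ≤ f n
  increasing-≥ zero    = z≤n
  increasing-≥ (suc n) = ≤-<-trans (increasing-≥ n) (increasing n)

-- The sets Z n and the functions h n

zElement : ℕ → ℕ → ℕ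
zElement n t = 2 ^ n * (2 * t + 1)

zElementᶜ : ∀ {B} → Computable₂In B zElement
zElementᶜ = uncurried (apply₂ *ᶜ (2^ᶜ ∘ᶜ π₁ᶜ)
  (apply₂ +ᶜ (apply₂ *ᶜ (constant 2) π₂ᶜ) (constant 1)))

zElement-increasing : ∀ n t → zElement n t ℕ.< zElement n (suc t)
zElement-increasing n t = *-monoʳ-< (2 ^ n) {{m^n≢0 2 n}} (+-monoˡ-< 1 (*-monoʳ-< 2 (n<1+n t)))

<-zElement : ∀ n t → t ℕ.< zElement n t
<-zElement n t = ≤-trans (≤-trans (≤-reflexive (+-comm 1 t)) (+-monoˡ-≤ 1 (m≤n*m t 2)))
  (m≤n*m (2 * t + 1) (2 ^ n) {{m^n≢0 2 n}})

-- The index is the 2-adic valuation: factors 2 are cancelled on both sides until one side is odd,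
-- and parity then decides.
Z-disjoint : ∀ m n {s t} → zElement m s ≡ zElement n t → m ≡ n
Z-disjoint zero    zero    _  = refl
Z-disjoint zero    (suc n) {s} {t} eq = contradiction (even≡odd n t s (sym eq)) λ ()
  where
  even≡odd : ∀ n t s → zElement (suc n) t ≡ zElement 0 s → 0 ≡ 1
  even≡odd n t s eq = begin
    0                                     ≡⟨ parity-+2* (zElement n t) 0 ⟨
    parity (2 * zElement n t + 0)         ≡⟨ cong parity (+-identityʳ (2 * zElement n t)) ⟩
    parity (2 * zElement n t)             ≡⟨ cong parity (*-assoc 2 (2 ^ n) (2 * t + 1)) ⟨
    parity (zElement (suc n) t)           ≡⟨ cong parity eq ⟩
    parity (zElement 0 s)                 ≡⟨ cong parity (*-identityˡ (2 * s + 1)) ⟩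
    parity (2 * s + 1)                    ≡⟨ parity-+2* s 1 ⟩
    1                                     ∎
    where open ≡-Reasoning
Z-disjoint (suc m) zero    {s} {t} eq = sym (Z-disjoint zero (suc m) {t} {s} (sym eq))
Z-disjoint (suc m) (suc n) {s} {t} eq = cong suc (Z-disjoint m n {s} {t}
  (*-cancelˡ-≡ (zElement m s) (zElement n t) 2
    (trans (sym (*-assoc 2 (2 ^ m) (2 * s + 1))) (trans eq (*-assoc 2 (2 ^ n) (2 * t + 1))))))

Z-computable : UniformlyComputableSets Z
Z-computable = proj₁ decider , λ
  { n k .1 (inside (t , eq)) →
      proj₂ decider n k 1 (inside (t , ≤-reflexive (sym eq) , s≤s (≤-reflexive eq)))
  ; n k .0 (outside k∉) →
      proj₂ decider n k 0 (outside λ (t , lo , hi) → k∉ (t , ≤-antisym (≤-pred hi) lo)) }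
  where
  -- Each element is presented as a half-open interval of length 1.
  decider = between-computable {lo = zElement} {hi = λ n t → suc (zElement n t)}
    zElementᶜ (uncurried (sucᶜ ∘ᶜ uncurry zElementᶜ))
    (λ n → monotone-≤ {zElement n} (zElement-increasing n)) (λ n k → m≤n⇒m≤1+n (<-zElement n k))

-- The elements of the blocks I_k, k ∈ Z n, listed in increasing order: the state ⟨ t , i ⟩
-- stands for the i-th element of the block with index zElement n t.

advance : ℕ → ℕ → ℕ
-- The difference is 0 exactly from the last position of the block onwards.
advance n w = if0 zElement n (π₁ w) ! ∸ suc (π₂ w)
  then ⟨ suc (π₁ w) , 0 ⟩
  else ⟨ π₁ w , suc (π₂ w) ⟩

state : ℕ → ℕ → ℕ
state n zero    = ⟨ 0 , 0 ⟩
state n (suc j) = advance n (state n j)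

element : ℕ → ℕ → ℕ
element n w = blockStart (zElement n (π₁ w)) + π₂ w

extra : ℕ → ℕ → ℕ
extra n j = element n (state n j)

extraᶜ : ∀ {B} → Computable₂In B extra
extraᶜ = uncurried (apply₂ +ᶜ (blockStartᶜ ∘ᶜ apply₂ zElementᶜ π₁ᶜ (π₁ᶜ ∘ᶜ uncurry stateᶜ))
                              (π₂ᶜ ∘ᶜ uncurry stateᶜ))
  where
  advanceᶜ : ∀ {B} → Computable₂In B advance
  advanceᶜ = uncurried (if0ᶜ
    (apply₂ ∸ᶜ (!ᶜ ∘ᶜ apply₂ zElementᶜ π₁ᶜ (π₁ᶜ ∘ᶜ π₂ᶜ)) (sucᶜ ∘ᶜ π₂ᶜ ∘ᶜ π₂ᶜ))
    ⟨ sucᶜ ∘ᶜ π₁ᶜ ∘ᶜ π₂ᶜ , constant 0 ⟩ᶜ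
    ⟨ π₁ᶜ ∘ᶜ π₂ᶜ , sucᶜ ∘ᶜ π₂ᶜ ∘ᶜ π₂ᶜ ⟩ᶜ)

  stateᶜ : ∀ {B} → Computable₂In B state
  stateᶜ = primitive-recursion {s = λ n _ w → advance n w}
    (constant ⟨ 0 , 0 ⟩) (apply₂ advanceᶜ π₁ᶜ (π₂ᶜ ∘ᶜ π₂ᶜ)) (λ _ → refl) (λ _ _ → refl)

Valid : ℕ → ℕ → Set
Valid n w = π₂ w ℕ.< zElement n (π₁ w) !

advance-within : ∀ n w → suc (π₂ w) ℕ.< zElement n (π₁ w) ! → advance n w ≡ ⟨ π₁ w , suc (π₂ w) ⟩
advance-within n w lt with zElement n (π₁ w) ! ∸ suc (π₂ w) in eq
... | zero  = contradiction lt (≤⇒≯ (m∸n≡0⇒m≤n eq))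
... | suc _ = refl

advance-beyond : ∀ n w → zElement n (π₁ w) ! ≤ suc (π₂ w) → advance n w ≡ ⟨ suc (π₁ w) , 0 ⟩
advance-beyond n w le rewrite m≤n⇒m∸n≡0 le = refl

element-pair : ∀ n t i → element n ⟨ t , i ⟩ ≡ blockStart (zElement n t) + i
element-pair n t i rewrite unpair-pair t i = refl

valid-pair : ∀ n t i → i ℕ.< zElement n t ! → Valid n ⟨ t , i ⟩
valid-pair n t i lt rewrite unpair-pair t i = lt

-- Both claims rest on the same case distinction. When a block is left, the increase holds because
-- the old position lies inside its block and the next block starts later.
advance-valid : ∀ n w → Valid n w → Valid n (advance n w) × element n w ℕ.< element n (advance n w)
advance-valid n w valid with m≤n⇒m<n∨m≡n valid
... | inj₁ lt rewrite advance-within n w lt =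
  valid-pair n (π₁ w) (suc (π₂ w)) lt ,
  subst (element n w ℕ.<_) (sym (element-pair n (π₁ w) (suc (π₂ w))))
    (+-monoʳ-< (blockStart (zElement n (π₁ w))) (n<1+n (π₂ w)))
... | inj₂ eq rewrite advance-beyond n w (≤-reflexive (sym eq)) =
  valid-pair n (suc (π₁ w)) 0 (1≤! (zElement n (suc (π₁ w)))) ,
  (begin-strict
    blockStart K + π₂ w             <⟨ +-monoʳ-< (blockStart K) valid ⟩
    blockStart (suc K)              ≤⟨ blockStart-mono (zElement-increasing n (π₁ w)) ⟩
    blockStart (zElement n (suc (π₁ w)))     ≡⟨ +-identityʳ _ ⟨
    blockStart (zElement n (suc (π₁ w))) + 0 ≡⟨ element-pair n (suc (π₁ w)) 0 ⟨
    element n ⟨ suc (π₁ w) , 0 ⟩    ∎)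
  where
  open ≤-Reasoning
  K = zElement n (π₁ w)

state-valid : ∀ n j → Valid n (state n j)
state-valid n zero    = valid-pair n 0 0 (1≤! (zElement n 0))
state-valid n (suc j) = proj₁ (advance-valid n (state n j) (state-valid n j))

extra-increasing : ∀ n j → extra n j ℕ.< extra n (suc j)
extra-increasing n j = proj₂ (advance-valid n (state n j) (state-valid n j))

extra∈Block : ∀ n j → ∃[ t ] extra n j ∈ Block (zElement n t)
extra∈Block n j = π₁ (state n j) , m≤m+n start (π₂ (state n j)) , +-monoʳ-< start (state-valid n j)
  where
  start = blockStart (zElement n (π₁ (state n j)))

state-within : ∀ n t {j} → state n j ≡ ⟨ t , 0 ⟩ →
               ∀ i → i ℕ.< zElement n t ! → state n (i + j) ≡ ⟨ t , i ⟩
state-within n t eq zero    _  = eq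
state-within n t eq (suc i) lt =
  trans (cong (advance n) (state-within n t eq i (<⇒≤ lt)))
    (trans (advance-within n ⟨ t , i ⟩
             (subst (λ (t , i) → suc i ℕ.< zElement n t !) (sym (unpair-pair t i)) lt))
      (cong (λ (t , i) → ⟨ t , suc i ⟩) (unpair-pair t i)))

state-reaches : ∀ n t → ∃[ j ] state n j ≡ ⟨ t , 0 ⟩
state-reaches n zero    = 0 , refl
state-reaches n (suc t) with j , eq ← state-reaches n t =
  -- `pred K!` steps lead from the first to the last position of the block, one more to the next
  -- block.
  suc (pred K! + j) , trans (cong (advance n) (state-within n t eq (pred K!) (≤-reflexive 1+K!-1)))
    (trans (advance-beyond n ⟨ t , pred K! ⟩
             (subst (λ (t , i) → zElement n t ! ≤ suc i) (sym (unpair-pair t (pred K!)))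
               (≤-reflexive (sym 1+K!-1))))
      (cong (λ (t , _) → ⟨ suc t , 0 ⟩) (unpair-pair t (pred K!))))
  where
  K! = zElement n t !

  1+K!-1 : suc (pred K!) ≡ K!
  1+K!-1 = suc-pred K! {{zElement n t !≢0}}

extra-reaches : ∀ n t →
  ∃[ j ] ∀ i → i ℕ.< zElement n t ! → extra n (i + j) ≡ blockStart (zElement n t) + i
extra-reaches n t with j , eq ← state-reaches n t =
  j , λ i lt → trans (cong (element n) (state-within n t eq i lt)) (element-pair n t i)

-- The functions `h n` and their fibres.

h : ℕ → ℕ → ℕ
h n x = if0 parity x then half x else extra n (half x)

h-uniform : UniformlyComputable h
h-uniform = code F , λ i x → subst (∅ ⊩ code F [ ⟨ i , x ⟩ ]⇓_)
    (cong₂ h (π₁-pair i x) (π₂-pair i x)) (correct F ⟨ i , x ⟩)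
  where
  F : ComputableIn ∅ (λ p → h (π₁ p) (π₂ p))
  F = if0ᶜ (parityᶜ ∘ᶜ π₂ᶜ) (halfᶜ ∘ᶜ π₂ᶜ) (apply₂ extraᶜ π₁ᶜ (halfᶜ ∘ᶜ π₂ᶜ))

h-computable : ∀ {B} n → ComputableIn B (h n)
h-computable n = if0ᶜ parityᶜ halfᶜ (apply₂ extraᶜ (constant n) halfᶜ)

h-double : ∀ n x → h n (2 * x) ≡ x
h-double n x = subst (λ y → h n y ≡ x) (+-identityʳ (2 * x)) even
  where
  even : h n (2 * x + 0) ≡ x
  even rewrite parity-+2* x 0 | half-+2* x 0 = +-identityʳ x

-- On a fixed parity, `h n` is `half` followed by the identity or by the strictly increasing
-- `extra n`.
h-injective : ∀ n {x y} → parity x ≡ parity y → h n x ≡ h n y → x ≡ y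
h-injective n {x} {y} same eq = parity-half-injective same (halves same eq)
  where
  halves : parity x ≡ parity y → h n x ≡ h n y → half x ≡ half y
  halves same eq with parity x | parity y
  halves refl eq | zero  | zero  = eq
  halves refl eq | suc _ | suc _ = increasing-injective (extra-increasing n) eq

same-half : ∀ {n x z p y} → parity x ≡ p → parity z ≡ p → h n x ≡ y → h n z ≡ y → x ≡ z
same-half {n} p q hx hz = h-injective n (trans p (sym q)) (trans hx (sym hz))

-- Among any three numbers two have the same parity, and on these `h n` is injective.
h-two-bounded : ∀ n y → CardAtMost 2 (fibre (h n) y)
h-two-bounded n y []           _ _ = z≤n
h-two-bounded n y (_ ∷ [])     _ _ = s≤s z≤n
h-two-bounded n y (_ ∷ _ ∷ []) _ _ = s≤s (s≤s z≤n)
h-two-bounded n y (a ∷ b ∷ c ∷ _) ((a≢b ∷ a≢c ∷ _) ∷ (b≢c ∷ _) ∷ _) (pa ∷ pb ∷ pc ∷ _)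
  with parity-binary a | parity-binary b | parity-binary c
... | inj₁ p | inj₁ q | _      = contradiction (same-half {n} p q pa pb) a≢b
... | inj₂ p | inj₂ q | _      = contradiction (same-half {n} p q pa pb) a≢b
... | inj₁ p | inj₂ _ | inj₁ r = contradiction (same-half {n} p r pa pc) a≢c
... | inj₂ p | inj₁ _ | inj₂ r = contradiction (same-half {n} p r pa pc) a≢c
... | inj₁ _ | inj₂ q | inj₂ r = contradiction (same-half {n} q r pb pc) b≢c
... | inj₂ _ | inj₁ q | inj₁ r = contradiction (same-half {n} q r pb pc) b≢c

-- Counting preimages of blocks.

pigeonhole : ∀ {n m} (g : ℕ → ℕ) → (∀ {i} → i ℕ.< n → g i ℕ.< m) →
             (∀ {i j} → i ℕ.< n → j ℕ.< n → g i ≡ g j → i ≡ j) → n ≤ m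
pigeonhole g bounded injective =
  injective⇒≤ {f = λ i → fromℕ< (bounded (toℕ<n i))} λ {i} {j} eq →
    toℕ-injective (injective (toℕ<n i) (toℕ<n j)
      (fromℕ<-injective (g (toℕ i)) (g (toℕ j)) (bounded (toℕ<n i)) (bounded (toℕ<n j)) eq))

half≤h : ∀ n x → half x ≤ h n x
half≤h n x with parity x
... | zero  = ≤-refl
... | suc _ = increasing-≥ (extra-increasing n) (half x)

half-< : ∀ {x m} → half x ℕ.< m → x ℕ.< 2 * m
half-< {x} {m} lt = begin-strict
  x                     ≡⟨ parity-half x ⟩
  2 * half x + parity x ≤⟨ +-monoʳ-≤ (2 * half x) (parity≤1 x) ⟩
  2 * half x + 1        <⟨ +-monoʳ-< (2 * half x) (n<1+n 1) ⟩
  2 * half x + 2        ≡⟨ +-comm (2 * half x) 2 ⟩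
  2 + 2 * half x        ≡⟨ *-suc 2 (half x) ⟨
  2 * suc (half x)      ≤⟨ *-monoʳ-≤ 2 lt ⟩
  2 * m                 ∎
  where
  open ≤-Reasoning
  parity≤1 : ∀ x → parity x ≤ 1
  parity≤1 zero    = z≤n
  parity≤1 (suc x) = m∸n≤m 1 (parity x)

<-half : ∀ {x m} → x ℕ.< 2 * m → half x ℕ.< m
<-half {x} {m} lt = *-cancelˡ-< 2 (half x) m
  (≤-<-trans (≤-trans (m≤m+n (2 * half x) (parity x)) (≤-reflexive (sym (parity-half x)))) lt)

-- Below the end of a block outside Z m, h m takes each value once on the even numbers,
-- while its values on the odd numbers lie below the start of that block.

h-preimage-bound : ∀ {m k} → k ∉ Z m → ∀ {n} (g : ℕ → ℕ) →
  (∀ {i} → i ℕ.< n → h m (g i) ℕ.< blockStart (suc k)) →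
  (∀ {i j} → i ℕ.< n → j ℕ.< n → g i ≡ g j → i ≡ j) →
  n ≤ blockStart (suc k) + blockStart k
h-preimage-bound {m} {k} k∉Z g below injective =
  pigeonhole (λ i → index (g i)) (λ {i} i<n → index-< {g i} (below i<n))
    (λ {i} {j} i<n j<n eq → injective i<n j<n
      (index-injective {g i} {g j} (below i<n) (below j<n) eq))
  where
  end = blockStart (suc k)

  -- Even numbers are numbered by their half, below `end`; odd ones come after `end`, and their half
  -- is below `blockStart k` because `j ≤ extra m j`.
  index : ℕ → ℕ
  index y = if0 parity y then half y else end + half y

  -- The value lies in a block with index in `Z m`, at most `k`; since `k ∉ Z m`, this index is less
  -- than `k`.
  extra-< : ∀ j → extra m j ℕ.< end → extra m j ℕ.< blockStart k
  extra-< j lt with t , lo , hi ← extra∈Block m j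
    with m≤n⇒m<n∨m≡n (≤-pred (blockStart-< {zElement m t} {suc k} lo lt))
  ... | inj₁ l<k  = <-≤-trans hi (blockStart-mono l<k)
  ... | inj₂ l≡k  = contradiction (t , sym l≡k) k∉Z

  index-< : ∀ {y} → h m y ℕ.< end → index y ℕ.< end + blockStart k
  index-< {y} lt with parity y
  ... | zero  = ≤-trans lt (m≤m+n end (blockStart k))
  ... | suc _ = +-monoʳ-< end (≤-<-trans (increasing-≥ (extra-increasing m) (half y))
                                       (extra-< (half y) lt))

  index-injective : ∀ {y z} → h m y ℕ.< end → h m z ℕ.< end → index y ≡ index z → y ≡ z
  index-injective {y} {z} y< z< eq = parity-half-injective (proj₁ both) (proj₂ both)
    where
    both : parity y ≡ parity z × half y ≡ half z
    both with parity-binary y | parity-binary z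
    ... | inj₁ p | inj₁ q rewrite p | q = refl , eq
    ... | inj₂ p | inj₂ q rewrite p | q = refl , +-cancelˡ-≡ end (half y) (half z) eq
    ... | inj₁ p | inj₂ q rewrite p | q = contradiction eq (<⇒≢ (<-≤-trans y< (m≤m+n end (half z))))
    ... | inj₂ p | inj₁ q rewrite p | q = contradiction (sym eq)
                                            (<⇒≢ (<-≤-trans z< (m≤m+n end (half y))))

-- g sends even numbers to the identity half of h n and odd numbers to its enumerating half.

h-block-preimage : ∀ n t → let k = zElement n t in
  Σ[ g ∈ (ℕ → ℕ) ] (Injective _≡_ _≡_ g × (∀ {i} → i ℕ.< 2 * k ! → h n (g i) ∈ Block k))
h-block-preimage n t with j , eq ← extra-reaches n t = g , g-injective , λ {i} lt →
  subst (blockStart k ≤_) (sym (h-g i (<-half lt))) (m≤m+n (blockStart k) (half i)) ,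
  subst (ℕ._< blockStart (suc k)) (sym (h-g i (<-half lt))) (+-monoʳ-< (blockStart k) (<-half lt))
  where
  k = zElement n t

  shift : ℕ → ℕ
  shift p = if0 p then blockStart k else j

  g : ℕ → ℕ
  -- The even summand preserves parity and adds `shift` to the half: even `i` start at
  -- `blockStart k`, odd `i` at the place `j` where the enumeration enters the block.
  g i = 2 * shift (parity i) + i

  parity-g : ∀ i → parity (g i) ≡ parity i
  parity-g i = parity-+2* (shift (parity i)) i

  g-injective : Injective _≡_ _≡_ g
  g-injective {x} {y} gx≡gy = +-cancelˡ-≡ (2 * shift (parity x)) x y
    (trans gx≡gy (cong (λ p → 2 * shift p + y)
      (trans (sym (parity-g y)) (trans (cong parity (sym gx≡gy)) (parity-g x)))))

  h-g : ∀ i → half i ℕ.< k ! → h n (g i) ≡ blockStart k + half i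
  h-g i lt rewrite parity-g i | half-+2* (shift (parity i)) i with parity i
  ... | zero  = refl
  ... | suc _ = trans (cong (extra n) (+-comm j (half i))) (eq (half i) lt)

-- Questions to ∅′

⟨⟩-injective : ∀ {a b c d} → ⟨ a , b ⟩ ≡ ⟨ c , d ⟩ → a ≡ c × b ≡ d
⟨⟩-injective {a} {b} {c} {d} eq =
  trans (sym (π₁-pair a b)) (trans (cong π₁ eq) (π₁-pair c d)) ,
  trans (sym (π₂-pair a b)) (trans (cong π₂ eq) (π₂-pair c d))

⌜comp⌝ : ℕ → ℕ → ℕ
⌜comp⌝ m n = ⟨ 6 , ⟨ m , n ⟩ ⟩

⌜pair⌝ : ℕ → ℕ → ℕ
⌜pair⌝ m n = ⟨ 5 , ⟨ m , n ⟩ ⟩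

-- With `payload`, this reduces the inversion of `⌜_⌝` to comparing components: a wrong constructor
-- is refuted by its tag alone.
tag : Code → ℕ
tag zero       = 0
tag succ       = 1
tag left       = 2
tag right      = 3
tag oracle     = 4
tag (pair _ _) = 5
tag (comp _ _) = 6
tag (prec _ _) = 7
tag (rfind _)  = 8

payload : Code → ℕ
payload (pair c d) = ⟨ ⌜ c ⌝ , ⌜ d ⌝ ⟩
payload (comp c d) = ⟨ ⌜ c ⌝ , ⌜ d ⌝ ⟩
payload (prec c d) = ⟨ ⌜ c ⌝ , ⌜ d ⌝ ⟩
payload (rfind c)  = ⌜ c ⌝
payload _          = 0

⌜⌝-tagged : ∀ c → ⌜ c ⌝ ≡ ⟨ tag c , payload c ⟩
⌜⌝-tagged zero       = refl
⌜⌝-tagged succ       = refl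
⌜⌝-tagged left       = refl
⌜⌝-tagged right      = refl
⌜⌝-tagged oracle     = refl
⌜⌝-tagged (pair _ _) = refl
⌜⌝-tagged (comp _ _) = refl
⌜⌝-tagged (prec _ _) = refl
⌜⌝-tagged (rfind _)  = refl

⌜comp⌝-inverse : ∀ c {m n} → ⌜ c ⌝ ≡ ⌜comp⌝ m n →
                 ∃[ d ] ∃[ e ] (c ≡ comp d e × ⌜ d ⌝ ≡ m × ⌜ e ⌝ ≡ n)
⌜comp⌝-inverse c {m} {n} eq = inverse c (⟨⟩-injective (trans (sym (⌜⌝-tagged c)) eq))
  where
  inverse : ∀ c → tag c ≡ 6 × payload c ≡ ⟨ m , n ⟩ →
            ∃[ d ] ∃[ e ] (c ≡ comp d e × ⌜ d ⌝ ≡ m × ⌜ e ⌝ ≡ n)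
  inverse (comp d e) (_ , eq) = d , e , refl , ⟨⟩-injective eq

⌜pair⌝-inverse : ∀ c {m n} → ⌜ c ⌝ ≡ ⌜pair⌝ m n →
                 ∃[ d ] ∃[ e ] (c ≡ pair d e × ⌜ d ⌝ ≡ m × ⌜ e ⌝ ≡ n)
⌜pair⌝-inverse c {m} {n} eq = inverse c (⟨⟩-injective (trans (sym (⌜⌝-tagged c)) eq))
  where
  inverse : ∀ c → tag c ≡ 5 × payload c ≡ ⟨ m , n ⟩ →
            ∃[ d ] ∃[ e ] (c ≡ pair d e × ⌜ d ⌝ ≡ m × ⌜ e ⌝ ≡ n)
  inverse (pair d e) (_ , eq) = d , e , refl , ⟨⟩-injective eq

-- This allows `query` to hard-wire arguments into a program computably, as in the s-m-n theorem.
numeralᶜ : ∀ {B} → ComputableIn B (λ n → ⌜ numeral n ⌝)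
numeralᶜ = primitive-recursion₁ {s = λ _ v → ⌜comp⌝ ⌜ succ ⌝ v}
  (uncurried ⟨ constant 6 , ⟨ constant ⌜ succ ⌝ , π₂ᶜ ⟩ᶜ ⟩ᶜ) (λ _ → refl)

-- Abstract, because the type checker would otherwise evaluate ⌜ guard ⌝ in unary.

abstract
  difference : ComputableIn ∅ (λ p → π₂ (π₁ p) ∸ π₁ (π₁ p))
  difference = apply₂ ∸ᶜ (π₂ᶜ ∘ᶜ π₁ᶜ) (π₁ᶜ ∘ᶜ π₁ᶜ)

  difference-⇓ : ∀ v y m → ∅ ⊩ code difference [ ⟨ ⟨ v , y ⟩ , m ⟩ ]⇓ (y ∸ v)
  difference-⇓ v y m = subst (∅ ⊩ code difference [ ⟨ ⟨ v , y ⟩ , m ⟩ ]⇓_) eq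
    (correct difference ⟨ ⟨ v , y ⟩ , m ⟩)
    where
    eq : π₂ (π₁ ⟨ ⟨ v , y ⟩ , m ⟩) ∸ π₁ (π₁ ⟨ ⟨ v , y ⟩ , m ⟩) ≡ y ∸ v
    eq rewrite unpair-pair ⟨ v , y ⟩ m | unpair-pair v y = refl

  -- The value tested by the search does not depend on the candidate, so the search succeeds at 0 or
  -- never; halting on `⟨ v , y ⟩` thus expresses `y ≤ v`.
  guard : Code
  guard = rfind (code difference)

  guard-halts : ∀ {v y} → y ≤ v → ∅ ⊩ guard [ ⟨ v , y ⟩ ]⇓ 0
  guard-halts {v} {y} y≤v = rfind⇓
    (subst (∅ ⊩ code difference [ ⟨ ⟨ v , y ⟩ , 0 ⟩ ]⇓_) (m≤n⇒m∸n≡0 y≤v) (difference-⇓ v y 0)) λ _ ()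

  guard-halts⁻¹ : ∀ {v y m} → ∅ ⊩ guard [ ⟨ v , y ⟩ ]⇓ m → y ≤ v
  guard-halts⁻¹ {v} {y} {m} (rfind⇓ d _) = m∸n≡0⇒m≤n (⇓-deterministic (difference-⇓ v y m) d)

-- p = ⟨ e , x ⟩ stands for the computation of the program with Gödel number e on input x.

Yields : ℕ → ℕ → Set
Yields p v = ∃[ c ] (⌜ c ⌝ ≡ π₁ p × ∅ ⊩ c [ π₂ p ]⇓ v)

Yields-deterministic : ∀ {p v w} → Yields p v → Yields p w → v ≡ w
Yields-deterministic (c , ec , dc) (d , ed , dd) 
  with refl ← ⌜⌝-injective {c} {d} (trans ec (sym ed)) =
  ⇓-deterministic dc dd

-- The Gödel number of exceeds c x y, for p = ⟨ ⌜ c ⌝ , x ⟩.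

query : ℕ → ℕ → ℕ
query p y = ⌜comp⌝ ⌜ guard ⌝
  (⌜pair⌝ (⌜comp⌝ (π₁ p) ⌜ numeral (π₂ p) ⌝) ⌜ numeral y ⌝)

queryᶜ : ∀ {B} → Computable₂In B query
queryᶜ = uncurried ⟨ constant 6 , ⟨ constant ⌜ guard ⌝ ,
  ⟨ constant 5 , ⟨ ⟨ constant 6 , ⟨ π₁ᶜ ∘ᶜ π₁ᶜ , numeralᶜ ∘ᶜ π₂ᶜ ∘ᶜ π₁ᶜ ⟩ᶜ ⟩ᶜ ,
    numeralᶜ ∘ᶜ π₂ᶜ ⟩ᶜ ⟩ᶜ ⟩ᶜ ⟩ᶜ

-- The input is ignored, so the self-application in the jump does no harm.
exceeds : Code → ℕ → ℕ → Code
exceeds c x y = comp guard (pair (comp c (numeral x)) (numeral y))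

exceeds-halts : ∀ {c x v y z} → ∅ ⊩ c [ x ]⇓ v → y ≤ v → ∅ ⊩ exceeds c x y [ z ]⇓ 0
exceeds-halts {x = x} {y = y} d y≤v =
  comp⇓ (pair⇓ (comp⇓ (numeral⇓ x) d) (numeral⇓ y)) (guard-halts y≤v)

exceeds-halts⁻¹ : ∀ {c x y z m} → ∅ ⊩ exceeds c x y [ z ]⇓ m → ∃[ v ] (∅ ⊩ c [ x ]⇓ v × y ≤ v)
exceeds-halts⁻¹ {x = x} {y} (comp⇓ (pair⇓ (comp⇓ dx d) dy) dg)
  with refl ← ⇓-deterministic dx (numeral⇓ x) | refl ← ⇓-deterministic dy (numeral⇓ y)
  = _ , d , guard-halts⁻¹ dg

-- `π₁ p` is not assumed to be a Gödel number; the program `c` is recovered by inverting the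
-- numbering layer by layer.
query-inverse : ∀ d p y → ⌜ d ⌝ ≡ query p y → ∃[ c ] (⌜ c ⌝ ≡ π₁ p × d ≡ exceeds c (π₂ p) y)
query-inverse d p y eq =
  let c₁ , c₂ , r , e₁ , e₂    = ⌜comp⌝-inverse d eq
      c₃ , c₄ , r′ , e₃ , e₄   = ⌜pair⌝-inverse c₂ e₂
      c₅ , c₆ , r″ , e₅ , e₆   = ⌜comp⌝-inverse c₃ e₃
  in c₅ , e₅ , trans r (cong₂ comp (⌜⌝-injective e₁)
       (trans r′ (cong₂ pair (trans r″ (cong (comp c₅) (⌜⌝-injective e₆))) (⌜⌝-injective e₄))))

Yields⇒query : ∀ {p v y} → Yields p v → y ≤ v → query p y ∈ ∅′
Yields⇒query {p} {v} {y} (c , eq , d) y≤v =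
  exceeds c (π₂ p) y ,
  cong (λ e → ⌜comp⌝ ⌜ guard ⌝ (⌜pair⌝ (⌜comp⌝ e ⌜ numeral (π₂ p) ⌝) ⌜ numeral y ⌝)) eq ,
  0 , exceeds-halts d y≤v

query⇒Yields : ∀ {p y} → query p y ∈ ∅′ → ∃[ v ] (Yields p v × y ≤ v)
query⇒Yields {p} {y} (d , eq , m , run) =
  let c , ec , d≡      = query-inverse d p y eq
      v , c⇓v , y≤v = exceeds-halts⁻¹ (subst (λ d → ∅ ⊩ d [ query p y ]⇓ m) d≡ run)
  in v , (c , ec , c⇓v) , y≤v

-- Reducibilities and profiles

-- The injection `f` maps each fibre of `g ∘ f` into a fibre of `g`, so the bound `b` survives.
≤₁-≤bfo-trans : ∀ {A B C} → A ≤₁ B → B ≤bfo C → A ≤bfo C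
≤₁-≤bfo-trans (f , (c , cf) , f-injective , f-red) (g , (d , dg) , b , 1≤b , g-red , g-bounded) =
  g ∘ f , (comp d c , λ x → comp⇓ (cf x) (dg (f x))) , b , 1≤b , (λ x → g-red (f x) ⇔-∘ f-red x) ,
  λ y xs unique all → subst (_≤ b) (length-map f xs)
    (g-bounded y (map f xs) (Unique.map⁺ f-injective unique) (All.map⁺ all))

≤bfo-refl : ∀ {A} → A ≤bfo A
≤bfo-refl {A} = id , (_ , correct identity) , 1 , ≤-refl , (λ _ → mk⇔ id id) , λ
  { y []          _                 _              → z≤n
  ; y (_ ∷ [])    _                 _              → ≤-refl
  ; y (_ ∷ _ ∷ _) ((a≢b ∷ _) ∷ _) (pa ∷ pb ∷ _) → contradiction (trans pa (sym pb)) a≢b }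

≤₁⇒≤bfo : ∀ {A B} → A ≤₁ B → A ≤bfo B
≤₁⇒≤bfo {A} {B} A≤B = ≤₁-≤bfo-trans {A} {B} {B} A≤B (≤bfo-refl {B})

coded-≤bfo : ∀ A n → coded A h n ≤bfo A
coded-≤bfo A n = h n , (_ , correct (h-computable n)) , 2 , s≤s z≤n , (λ _ → mk⇔ id id) ,
  h-two-bounded n

-- Doubling is an injective right inverse of every `h n`.
≤₁-coded : ∀ A n → A ≤₁ coded A h n
≤₁-coded A n = (2 *_) , (_ , correct (apply₂ *ᶜ (constant 2) identity)) ,
  (λ {x} {y} → *-cancelˡ-≡ x y 2) ,
  λ x → mk⇔ (subst A (sym (h-double n x))) (subst A (h-double n x))

twoValued-antichain : ∀ {α β} (1<α : 1ℚ < α) (α<β : α < β) (β<2 : β < 2ℚ) {i j} →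
  twoValued 1<α α<β β<2 i ≼ twoValued 1<α α<β β<2 j → i ≡ j
twoValued-antichain {α} {β} 1<α α<β β<2 {i} {j} u≼w with i ≟ j
... | yes i≡j = i≡j
... | no  i≢j = contradiction (ℚ.<-≤-trans α<β β≤α) (ℚ.<-irrefl refl)
  where
  -- This is `2 ^ i`, the least element of `Z i`: the left profile is `β` there, the right one `α`
  -- as `i ≢ j`.
  k = zElement i 0

  value : Bool → ℚ
  value b = proj₁ {B = λ q → 1ℚ ℚ.< q × q ℚ.< 2ℚ}
    (if b then (β , ℚ.<-trans 1<α α<β , β<2) else (α , 1<α , ℚ.<-trans α<β β<2))

  β≤α : β ℚ.≤ α
  β≤α = subst₂ ℚ._≤_ (cong value (dec-true (Z? i k) (0 , refl)))
    (cong value (dec-false (Z? j k) λ (t , eq) → i≢j (Z-disjoint i j {0} {t} eq))) (u≼w k)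

-- The set A

module Construction (em : ExcludedMiddle 0ℓ) where

  -- Excluded middle turns the oracle into a total function, as `minimisation` requires.
  ∅′-value : ℕ → ℕ
  ∅′-value e with em {e ∈ ∅′}
  ... | yes _ = 1
  ... | no  _ = 0

  ∅′-valueᶜ : ComputableIn ∅′ ∅′-value
  ∅′-valueᶜ = computes λ e → oracle⇓ (value e)
    where
    value : ∀ e → χ ∅′ e (∅′-value e)
    value e with em {e ∈ ∅′}
    ... | yes e∈ = inside e∈
    ... | no  e∉ = outside e∉

  ∅′-value-∉ : ∀ {e} → e ∉ ∅′ → ∅′-value e ≡ 0
  ∅′-value-∉ {e} e∉ with em {e ∈ ∅′}
  ... | yes e∈ = contradiction e∈ e∉
  ... | no  _  = refl

  ∅′-value-∈ : ∀ {e} → e ∈ ∅′ → ∅′-value e ≢ 0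
  ∅′-value-∈ {e} e∈ with em {e ∈ ∅′}
  ... | yes _ = λ ()
  ... | no e∉ = contradiction e∈ e∉

  -- The successor reserves 0 for divergence and makes `bound p` the least `y` with
  -- `query p y ∉ ∅′`.
  bound : ℕ → ℕ
  bound p with em {∃[ v ] Yields p v}
  ... | yes (v , _) = suc v
  ... | no  _       = 0

  <-bound : ∀ {p v} → Yields p v → v ℕ.< bound p
  <-bound {p} y with em {∃[ v ] Yields p v}
  ... | yes (w , y′) = s≤s (≤-reflexive (Yields-deterministic {p} y y′))
  ... | no  none     = contradiction (_ , y) none

  <bound⇒Yields : ∀ {p y} → y ℕ.< bound p → ∃[ v ] (Yields p v × y ≤ v)
  <bound⇒Yields {p} y<b with em {∃[ v ] Yields p v}
  ... | yes (v , yields) = v , yields , ≤-pred y<b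

  boundᶜ : ComputableIn ∅′ bound
  boundᶜ = minimisation {f = λ p y → ∅′-value (query p y)} (uncurried (∅′-valueᶜ ∘ᶜ uncurry queryᶜ))
    (λ p → ∅′-value-∉ {query p (bound p)} (unbounded p))
    (λ p y y<bound → ∅′-value-∈ {query p y} (bounded p y y<bound))
    where
    unbounded : ∀ p → query p (bound p) ∉ ∅′
    unbounded p q∈ = let v , y , b≤v = query⇒Yields {p} {bound p} q∈ in <⇒≱ (<-bound {p} y) b≤v

    bounded : ∀ p y → y ℕ.< bound p → query p y ∈ ∅′
    bounded p y y<b = let v , yields , y≤v = <bound⇒Yields {p} y<b in
      Yields⇒query {p} {v} {y} yields y≤v

  -- Stage s = ⟨ e , n ⟩ handles program e and puts into A one block with index in Z n;
  -- the index of the next one exceeds the output of e on the present one.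

  marker : ℕ → ℕ
  -- Stage 0 is `⟨ 0 , 0 ⟩`, so the index must lie in `Z 0`; this one is 9, large enough for
  -- `blockStart-growth`.
  marker zero    = zElement 0 4
  -- The program is that of stage `s`, the set `Z` that of stage `suc s`. As `t < zElement n t`, the
  -- new index exceeds both summands.
  marker (suc s) = zElement (π₂ (suc s)) (marker s + bound ⟨ π₁ s , marker s ⟩)

  markerᶜ : ComputableIn ∅′ marker
  markerᶜ = primitive-recursion₁
    {s = λ s k → zElement (π₂ (suc s)) (k + bound ⟨ π₁ s , k ⟩)}
    (uncurried (apply₂ zElementᶜ (π₂ᶜ ∘ᶜ sucᶜ ∘ᶜ π₁ᶜ)
      (apply₂ +ᶜ π₂ᶜ (boundᶜ ∘ᶜ ⟨ π₁ᶜ ∘ᶜ π₁ᶜ , π₂ᶜ ⟩ᶜ)))) (λ _ → refl)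

  marker∈Z : ∀ s → ∃[ t ] marker s ≡ zElement (π₂ s) t
  marker∈Z zero    = 4 , refl
  marker∈Z (suc s) = marker s + bound ⟨ π₁ s , marker s ⟩ , refl

  marker-step : ∀ s → marker s + bound ⟨ π₁ s , marker s ⟩ ℕ.< marker (suc s)
  marker-step s = <-zElement (π₂ (suc s)) (marker s + bound ⟨ π₁ s , marker s ⟩)

  marker-increasing : ∀ s → marker s ℕ.< marker (suc s)
  marker-increasing s = ≤-<-trans (m≤m+n (marker s) (bound ⟨ π₁ s , marker s ⟩)) (marker-step s)

  4≤marker : ∀ s → 4 ≤ marker s
  4≤marker s = ≤-trans (m≤m+n 4 5) (monotone-≤ {marker} marker-increasing {0} {s} z≤n)

  -- At stage `⟨ ⌜ code cf ⌝ , n ⟩` the number `bound` exceeds the output of this program on the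
  -- marker, and the next marker exceeds `bound`.
  marker-escapes : ∀ {f} → ComputableIn ∅ f → ∀ n →
    ∃[ s ] ∃[ t ] (marker s ≡ zElement n t × f (marker s) ℕ.< marker (suc s))
  marker-escapes {f} cf n = s , t , trans eq (cong (λ n → zElement n t) (π₂-pair ⌜ code cf ⌝ n)) ,
    <-trans (<-≤-trans (<-bound {⟨ π₁ s , marker s ⟩} yields) (m≤n+m _ (marker s))) (marker-step s)
    where
    s = ⟨ ⌜ code cf ⌝ , n ⟩
    t = proj₁ (marker∈Z s)
    eq = proj₂ (marker∈Z s)

    yields : Yields ⟨ π₁ s , marker s ⟩ (f (marker s))
    yields = code cf ,
      trans (sym (π₁-pair ⌜ code cf ⌝ n)) (sym (π₁-pair (π₁ s) (marker s))) ,
      subst (∅ ⊩ code cf [_]⇓ f (marker s)) (sym (π₂-pair (π₁ s) (marker s))) (correct cf (marker s))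

  A : Subset
  A x = ∃[ s ] x ∈ Block (marker s)

  A-constant-on-blocks : ∀ k {x y} → x ∈ Block k → y ∈ Block k → x ∈ A → y ∈ A
  A-constant-on-blocks k (k≤x , x<k) y∈ (s , s≤x , x<s)
    with refl ← ≤-antisym (≤-pred (blockStart-< {k} {suc (marker s)} k≤x x<s))
                          (≤-pred (blockStart-< {marker s} {suc k} s≤x x<k)) = s , y∈

  A≤T∅′ : A ≤T ∅′
  -- The decider expects a family of sets, here constant; 0 is supplied as a dummy index.
  A≤T∅′ = comp (proj₁ decider) (pair zero (code (identity {∅′}))) ,
    λ x v χv → comp⇓ (pair⇓ zero⇓ (correct identity x)) (proj₂ decider 0 x v χv)
    where
    decider = between-computable {∅′}
      {lo = λ _ s → blockStart (marker s)} {hi = λ _ s → blockStart (suc (marker s))}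
      (uncurried (blockStartᶜ ∘ᶜ markerᶜ ∘ᶜ π₂ᶜ))
      (uncurried (blockStartᶜ ∘ᶜ sucᶜ ∘ᶜ markerᶜ ∘ᶜ π₂ᶜ))
      (λ _ s≤t → blockStart-mono (monotone-≤ marker-increasing s≤t))
      (λ _ x → ≤-trans (s≤s (increasing-≥ marker-increasing x)) (≤-blockStart (suc (marker x))))

  -- Since `k ≤ blockStart k`, the blocks of all later stages start at or above `marker (suc s)`.
  A-below-next-marker : ∀ {s x} → x ∈ A → x ℕ.< marker (suc s) → x ℕ.< blockStart (suc (marker s))
  A-below-next-marker {s} {x} (r , r≤x , x<r) x<next =
    <-≤-trans x<r (blockStart-mono (s≤s (monotone-≤ marker-increasing r≤s)))
    where
    r≤s : r ≤ s
    r≤s = ≮⇒≥ λ s<r → <⇒≱ x<next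
      (≤-trans (monotone-≤ marker-increasing s<r) (≤-trans (≤-blockStart (marker r)) r≤x))

  coded-separated : ∀ {n m} → n ≢ m → ¬ (coded A h n ≤₁ coded A h m)
  coded-separated {n} {m} n≢m (f , (c , cf) , f-injective , red) =
    refute (marker-escapes outputᶜ n)
    where
    output : ℕ → ℕ
    -- If `h n x` lies in block `k`, then `half x ≤ h n x` gives `x < 2 * blockStart (suc k)`; so
    -- the sum bounds `h m (f x)` for all such `x`.
    output k = sumBelow (h m ∘ f) (2 * blockStart (suc k))

    outputᶜ : ComputableIn ∅ output
    outputᶜ = sumBelowᶜ (h-computable m ∘ᶜ computes cf)
      ∘ᶜ apply₂ *ᶜ (constant 2) (blockStartᶜ ∘ᶜ sucᶜ)

    refute : ¬ (∃[ s ] ∃[ t ] (marker s ≡ zElement n t × output (marker s) ℕ.< marker (suc s)))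
    refute (s , t , eq , output<next) =
      let g , g-injective , in-block = h-block-preimage n t in
      <⇒≱ too-few (h-preimage-bound {m} {zElement n t}
        (λ (t′ , eq′) → n≢m (Z-disjoint n m {t} {t′} eq′)) (f ∘ g)
        (λ {i} i< → below (g i) (in-block i<)) (λ _ _ eq → g-injective (f-injective eq)))
      where
      K = zElement n t

      -- The reduction puts `h m (f x)` into `A`, and as a summand of `output (marker s)` it is
      -- below the next marker.
      below : ∀ x → h n x ∈ Block K → h m (f x) ℕ.< blockStart (suc K)
      below x hx∈@(_ , hx<) = subst (λ k → h m (f x) ℕ.< blockStart (suc k)) eq
        (A-below-next-marker {s} (Equivalence.to (red x)
            (s , subst (λ k → h n x ∈ Block k) (sym eq) hx∈))
          (≤-<-trans (≤-sumBelow (h m ∘ f) (half-< (≤-<-trans (half≤h n x)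
            (subst (λ k → h n x ℕ.< blockStart (suc k)) (sym eq) hx<)))) output<next))

      too-few : blockStart (suc K) + blockStart K ℕ.< 2 * K !
      too-few = begin-strict
        blockStart K + K ! + blockStart K     ≡⟨ +-comm (blockStart K + K !) (blockStart K) ⟩
        blockStart K + (blockStart K + K !)   ≡⟨ +-assoc (blockStart K) (blockStart K) (K !) ⟨
        blockStart K + blockStart K + K !     ≡⟨ cong (λ b → blockStart K + b + K !)
                                                    (+-identityʳ (blockStart K)) ⟨
        2 * blockStart K + K !                <⟨ +-monoˡ-< (K !)
                                                    (blockStart-growth (subst (4 ≤_) eq (4≤marker s))) ⟩
        K ! + K !                             ≡⟨ cong (K ! +_) (+-identityʳ (K !)) ⟨
        2 * K !                               ∎
        where open ≤-Reasoning

  -- The antichain of 1-degrees.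

  coded-≤₁⇒≡ : ∀ n m → coded A h n ≤₁ coded A h m → n ≡ m
  coded-≤₁⇒≡ n m n≤m with n ≟ m
  ... | yes n≡m = n≡m
  ... | no  n≢m = contradiction n≤m (coded-separated n≢m)

  coded-≡bfo-A : ∀ n → coded A h n ≡bfo A
  coded-≡bfo-A n = record
    { lhs≤rhs = coded-≤bfo A n ; rhs≤lhs = ≤₁⇒≤bfo {A} {coded A h n} (≤₁-coded A n) }

  infiniteAntichain : InfiniteAntichain OneDegrees (OneDegreesOf (coded A h))
  infiniteAntichain =
    (coded A h , (λ n → n , record { lhs≤rhs = reflexive n ; rhs≤lhs = reflexive n }) ,
      λ {n} {m} n≈m → coded-≤₁⇒≡ n m (lhs≤rhs n≈m)) ,
    antichain
    where
    reflexive : ∀ n → coded A h n ≤₁ coded A h n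
    reflexive n = ≤₁-refl {coded A h n}

    antichain : ∀ {X Y} → X ∈ OneDegreesOf (coded A h) → Y ∈ OneDegreesOf (coded A h) →
                ¬ (X ≡₁ Y) → ¬ (X ≤₁ Y)
    antichain {X} {Y} (n , X≡n) (m , Y≡m) X≢Y X≤Y
      -- The reduction transfers to the representatives `coded A h n` and `coded A h m`, so `n` and
      -- `m` agree and `X` and `Y` share a degree.
      with refl ← coded-≤₁⇒≡ n m (≤₁-trans {coded A h n} {X} {coded A h m} (rhs≤lhs X≡n)
                    (≤₁-trans {X} {Y} {coded A h m} X≤Y (lhs≤rhs Y≡m))) =
      X≢Y (record
        { lhs≤rhs = X≤Y
        ; rhs≤lhs = ≤₁-trans {Y} {coded A h n} {X} (lhs≤rhs Y≡m) (rhs≤lhs X≡n) })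

  degrees⊆degbfo : OneDegreesOf (coded A h) ⊆ degbfo A
  degrees⊆degbfo {X} (n , X≡n) = record
    { lhs≤rhs = ≤₁-≤bfo-trans {X} {coded A h n} {A} (lhs≤rhs X≡n) (coded-≤bfo A n)
    ; rhs≤lhs = ≤₁⇒≤bfo {A} {X}
        (≤₁-trans {A} {coded A h n} {X} (≤₁-coded A n) (rhs≤lhs X≡n)) }

corollary3p5 : ExcludedMiddle 0ℓ →
    (α β : ℚ) (1<α : 1ℚ < α) (α<β : α < β) (β<2 : β < 2ℚ) →
    (∀ n m → n ≢ m → Empty (Z n ∩ Z m))
    × (∀ n → Infinite _≡_ (Z n))
    × UniformlyComputableSets Z
    × (Σ[ A ∈ Subset ] Σ[ h ∈ (ℕ → ℕ → ℕ) ]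
    ( A ≤T ∅′
    × UniformlyComputable h
    × (∀ n → Surjective _≡_ _≡_ (h n))
    × IsProfileCoding (twoValued 1<α α<β β<2) _≢_ A h
    × (∀ n → coded A h n ≡bfo A)
    × (∀ n m → n ≢ m → ¬ (coded A h n ≤₁ coded A h m))
    × InfiniteAntichain OneDegrees (OneDegreesOf (coded A h))
    × OneDegreesOf (coded A h) ⊆ degbfo A ))
corollary3p5 em α β 1<α α<β β<2 =
  (λ n m n≢m k ((s , k≡s) , (t , k≡t)) → n≢m (Z-disjoint n m {s} {t} (trans (sym k≡s) k≡t))) ,
  (λ n → zElement n , (λ t → t , refl) , increasing-injective (zElement-increasing n)) ,
  Z-computable ,
  A , h , A≤T∅′ , h-uniform ,
  (λ n y → 2 * y , λ { refl → h-double n y }) ,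
  record
    { constant-on-blocks = A-constant-on-blocks
    ; two-bounded        = h-two-bounded
    ; coded-≡bfo         = coded-≡bfo-A
    ; monotone           = λ {i} {j} u≼w → subst (λ j → coded A h i ≤₁ coded A h j)
        (twoValued-antichain 1<α α<β β<2 u≼w) (≤₁-refl {coded A h i})
    ; separated          = coded-separated
    } ,
  coded-≡bfo-A , (λ n m → coded-separated) , infiniteAntichain , degrees⊆degbfo
  where open Construction em
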